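{- Let $(\lambda_n)_{n\ge1}$ be a strictly increasing sequence of positive real numbers with $\lambda_n\to\infty$, let $\phi(x,y)$ be any complex-valued function of two variables, and let $x_1,x_2\ge0$ be real. Then $$\sum_{\lambda_m\le x_1}\sum_{\lambda_n\le x_2}\phi(\lambda_m,\lambda_n)=\mathop{\sum\sum}_{\lambda_m\lambda_n\le x_1x_2}\phi(\lambda_m,\lambda_n)-\sum_{\lambda_m\le x_1}\ \sum_{x_2<\lambda_n\le x_1x_2/\lambda_m}\phi(\lambda_m,\lambda_n)-\sum_{\lambda_n\le x_2}\ \sum_{x_1<\lambda_m\le x_1x_2/\lambda_n}\phi(\lambda_m,\lambda_n).$$
   Context: Sums run over indices $m,n\ge1$ satisfying the displayed conditions; empty sums are zero. -}

module Defs where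

open import Algebra.Bundles using (AbelianGroup; CommutativeRing)
import Algebra.Construct.DirectProduct as DirectProduct
import Algebra.Properties.Ring as RingProperties
open import Algebra.Structures using (IsCommutativeRing)
open import Data.List.Base using (List; map; foldr; filter; upTo; cartesianProduct)
open import Data.List.Membership.Propositional using (_∈_)
open import Data.List.Membership.Propositional.Properties
  using (∈-filter⁺; ∈-filter⁻; ∈-upTo⁺; ∈-cartesianProduct⁺)
open import Data.List.Relation.Unary.Unique.Propositional using (Unique)
import Data.List.Relation.Unary.Unique.Propositional.Properties as Uniqueₚ
open import Data.Nat.Base as ℕ using (ℕ; zero; suc)
import Data.Nat.Properties as ℕₚ
open import Data.Product.Base using (_×_; _,_; ∃; ∃-syntax; proj₁; proj₂)
open import Data.Sum.Base using (inj₁; inj₂)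
open import Level using (_⊔_) renaming (suc to lsuc)
open import Relation.Binary.Bundles using (DecTotalOrder)
open import Relation.Binary.Core using (Rel)
import Relation.Binary.Construct.NonStrictToStrict as NonStrictToStrict
open import Relation.Binary.Structures using (IsDecTotalOrder)
import Relation.Binary.Reasoning.Setoid as SetoidReasoning
open import Relation.Nullary using (¬_; Dec; yes; no; contradiction)
open import Relation.Nullary.Decidable using (_×-dec_)
open import Relation.Unary using (Pred; Decidable; Satisfiable)

-- The real numbers, characterised (up to isomorphism) as the Dedekind-complete
-- ordered field.  The order is that of classical analysis: it is total and
-- decidable, so that conditions such as "λₙ ≤ x" can be used to select the
-- terms of a sum.
record RealNumbers c ℓ₁ ℓ₂ : Set (lsuc (c ⊔ ℓ₁ ⊔ ℓ₂)) where
  infix  8 _⁻¹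
  infixl 7 _*_ _/_
  infixl 6 _+_
  infix  4 _≈_ _≤_

  field
    Carrier : Set c
    _≈_     : Rel Carrier ℓ₁
    _≤_     : Rel Carrier ℓ₂
    _+_ _*_ : Carrier → Carrier → Carrier
    -_      : Carrier → Carrier
    0# 1#   : Carrier
    -- Total by convention; the value at 0# is unspecified.
    _⁻¹     : Carrier → Carrier

    isCommutativeRing : IsCommutativeRing _≈_ _+_ _*_ -_ 0# 1#
    0≉1               : ¬ (0# ≈ 1#)
    ⁻¹-cong           : ∀ {x y} → x ≈ y → x ⁻¹ ≈ y ⁻¹
    ⁻¹-inverseʳ       : ∀ {x} → ¬ (x ≈ 0#) → x * x ⁻¹ ≈ 1#

    isDecTotalOrder   : IsDecTotalOrder _≈_ _≤_

  open NonStrictToStrict _≈_ _≤_ public using (_<_)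

  UpperBound : ∀ {p} → Pred Carrier p → Pred Carrier (c ⊔ ℓ₂ ⊔ p)
  UpperBound S b = ∀ x → S x → x ≤ b

  field
    +-monoʳ-≤         : ∀ z {x y} → x ≤ y → z + x ≤ z + y
    *-pos             : ∀ {x y} → 0# < x → 0# < y → 0# < x * y
    supremum          : (S : Pred Carrier (c ⊔ ℓ₁ ⊔ ℓ₂)) → Satisfiable S → ∃ (UpperBound S) →
                        ∃[ s ] (UpperBound S s × (∀ b → UpperBound S b → s ≤ b))

  commutativeRing : CommutativeRing c ℓ₁
  commutativeRing = record { isCommutativeRing = isCommutativeRing }

  decTotalOrder : DecTotalOrder c ℓ₁ ℓ₂
  decTotalOrder = record { isDecTotalOrder = isDecTotalOrder }

  open CommutativeRing commutativeRing public
    using (ring; setoid; +-abelianGroup; +-cong; +-congˡ; +-congʳ; +-comm; +-assoc;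
           +-identityˡ; +-identityʳ; -‿inverseˡ; -‿inverseʳ;
           *-cong; *-congˡ; *-congʳ; *-comm; *-assoc; *-identityˡ; *-identityʳ; distribˡ; distribʳ)
    renaming (refl to ≈-refl; sym to ≈-sym; trans to ≈-trans)
  open DecTotalOrder decTotalOrder public
    using (_≟_; _≤?_; antisym; total; ≤-respˡ-≈; ≤-respʳ-≈)
    renaming (refl to ≤-refl; reflexive to ≤-reflexive; trans to ≤-trans)

  _/_ : Carrier → Carrier → Carrier
  x / y = x * y ⁻¹

  _<?_ : ∀ x y → Dec (x < y)
  _<?_ = NonStrictToStrict.<-decidable _≈_ _≤_ _≟_ _≤?_

  <⇒≱ : ∀ {x y} → x < y → ¬ (y ≤ x)
  <⇒≱ = NonStrictToStrict.<⇒≱ _≈_ _≤_ antisym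

  <-≤-trans : ∀ {x y z} → x < y → y ≤ z → x < z
  <-≤-trans = NonStrictToStrict.<-≤-trans _≈_ _≤_ ≈-sym ≤-trans antisym ≤-respʳ-≈

  0<y-x : ∀ {x y} → x < y → 0# < (- x) + y
  0<y-x {x} {y} (x≤y , x≉y) =
    ≤-respˡ-≈ (-‿inverseˡ x) (+-monoʳ-≤ (- x) x≤y) ,
    λ 0≈ → x≉y (RingProperties.+-cancelˡ ring (- x) x y (≈-trans (-‿inverseˡ x) 0≈))

  *-monoˡ-< : ∀ {x y z} → 0# < z → x < y → x * z < y * z
  *-monoˡ-< {x} {y} {z} 0<z x<y =
    ≤-respˡ-≈ (+-identityʳ _) (≤-respʳ-≈ xz+d≈yz (+-monoʳ-≤ (x * z) (proj₁ 0<d))) ,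
    λ xz≈yz → proj₂ 0<d (RingProperties.+-cancelˡ ring (x * z) _ _
      (≈-trans (+-identityʳ _) (≈-trans xz≈yz (≈-sym xz+d≈yz))))
    where
    d = ((- x) + y) * z
    0<d : 0# < d
    0<d = *-pos (0<y-x x<y) 0<z
    xz+d≈yz : x * z + d ≈ y * z
    xz+d≈yz = begin
      x * z + ((- x) + y) * z ≈⟨ distribʳ z x ((- x) + y) ⟨
      (x + ((- x) + y)) * z   ≈⟨ *-congʳ (≈-sym (+-assoc x (- x) y)) ⟩
      ((x + (- x)) + y) * z   ≈⟨ *-congʳ (+-congʳ (-‿inverseʳ x)) ⟩
      (0# + y) * z            ≈⟨ *-congʳ (+-identityˡ y) ⟩
      y * z                   ∎
      where open SetoidReasoning setoid

  *-monoˡ-≤ : ∀ {x y z} → 0# < z → x ≤ y → x * z ≤ y * z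
  *-monoˡ-≤ {x} {y} 0<z x≤y with x ≟ y
  ... | yes x≈y = ≤-reflexive (*-congʳ x≈y)
  ... | no  x≉y = proj₁ (*-monoˡ-< 0<z (x≤y , x≉y))

  x/y*y≈x : ∀ x {y} → 0# < y → (x / y) * y ≈ x
  x/y*y≈x x {y} (_ , 0≉y) = begin
    x * y ⁻¹ * y   ≈⟨ *-assoc x (y ⁻¹) y ⟩
    x * (y ⁻¹ * y) ≈⟨ *-congˡ (*-comm (y ⁻¹) y) ⟩
    x * (y * y ⁻¹) ≈⟨ *-congˡ (⁻¹-inverseʳ (λ y≈0 → 0≉y (≈-sym y≈0))) ⟩
    x * 1#         ≈⟨ *-identityʳ x ⟩
    x              ∎
    where open SetoidReasoning setoid

  TendsToInfinity : (ℕ → Carrier) → Set _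
  TendsToInfinity a = ∀ K → ∃[ N ] (∀ n → N ℕ.≤ n → K < a n)

-- ℂ = ℝ × ℝ (real and imaginary part), of which finite sums and differences
-- only involve the componentwise additive structure.
module Complex {c ℓ₁ ℓ₂} (R : RealNumbers c ℓ₁ ℓ₂) where

  ℂ-+-abelianGroup : AbelianGroup c ℓ₁
  ℂ-+-abelianGroup = DirectProduct.abelianGroup +-abelianGroup +-abelianGroup
    where open RealNumbers R

  open AbelianGroup ℂ-+-abelianGroup public
    using () renaming (Carrier to ℂ; _≈_ to _≈ℂ_; ε to 0ℂ; _∙_ to _+ℂ_; _-_ to _-ℂ_)

-- A witness that P is a finite subset of A: a list of all its elements,
-- without repetition.
record Finite {a p} {A : Set a} (P : Pred A p) : Set (a ⊔ p) where
  field
    elements : List A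
    unique   : Unique elements
    sound    : ∀ {x} → x ∈ elements → P x
    complete : ∀ {x} → P x → x ∈ elements

module _ {a p} {A : Set a} {P : Pred A p} (P? : Decidable P) where

  finite : (xs : List A) → Unique xs → (∀ {x} → P x → x ∈ xs) → Finite P
  finite xs xs! P⊆xs = record
    { elements = filter P? xs
    ; unique   = Uniqueₚ.filter⁺ P? xs!
    ; sound    = λ x∈ → proj₂ (∈-filter⁻ P? {xs = xs} x∈)
    ; complete = λ px → ∈-filter⁺ P? (P⊆xs px) px
    }

module FiniteSum {c ℓ₁ ℓ₂} (R : RealNumbers c ℓ₁ ℓ₂) where

  open Complex R

  sum : ∀ {a p} {A : Set a} {P : Pred A p} → Finite P → (A → ℂ) → ℂ
  sum F f = foldr _+ℂ_ 0ℂ (map f (Finite.elements F))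

  infix 7 sum
  syntax sum F (λ x → e) = ∑[ x ∈ F ] e

-- The index sets of the sums.  A sequence (λₙ)ₙ≥₁ is represented by
-- Λ : ℕ → ℝ with Λ n = λₙ₊₁.
module IndexSets {c ℓ₁ ℓ₂} (R : RealNumbers c ℓ₁ ℓ₂) where

  open RealNumbers R

  module Sequence (Λ : ℕ → Carrier)
    (Λ-positive   : ∀ n → 0# < Λ n)
    (Λ-increasing : ∀ {m n} → m ℕ.< n → Λ m < Λ n)
    (Λ→∞          : TendsToInfinity Λ)
    where

    Λ₀≤Λ : ∀ n → Λ 0 ≤ Λ n
    Λ₀≤Λ zero    = ≤-refl
    Λ₀≤Λ (suc n) = proj₁ (Λ-increasing ℕ.z<s)

    bound : ∀ K {n} → Λ n ≤ K → n ℕ.< proj₁ (Λ→∞ K)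
    bound K {n} Λn≤K with ℕₚ.<-≤-connex n (proj₁ (Λ→∞ K))
    ... | inj₁ n<N = n<N
    ... | inj₂ N≤n = contradiction Λn≤K (<⇒≱ (proj₂ (Λ→∞ K) n N≤n))

    boundˡ : ∀ z m {n} → Λ n * Λ m ≤ z → n ℕ.< proj₁ (Λ→∞ (z / Λ 0))
    boundˡ z m {n} ΛnΛm≤z with ℕₚ.<-≤-connex n (proj₁ (Λ→∞ (z / Λ 0)))
    ... | inj₁ n<N = n<N
    ... | inj₂ N≤n = contradiction ΛnΛm≤z (<⇒≱ (<-≤-trans z<ΛnΛ₀ ΛnΛ₀≤ΛnΛm))
      where
      z<ΛnΛ₀ : z < Λ n * Λ 0
      z<ΛnΛ₀ = NonStrictToStrict.<-respˡ-≈ _≈_ _≤_ ≈-trans ≤-respˡ-≈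
        (x/y*y≈x z (Λ-positive 0))
        (*-monoˡ-< (Λ-positive 0) (proj₂ (Λ→∞ (z / Λ 0)) n N≤n))
      ΛnΛ₀≤ΛnΛm : Λ n * Λ 0 ≤ Λ n * Λ m
      ΛnΛ₀≤ΛnΛm = ≤-respˡ-≈ (*-comm (Λ 0) (Λ n)) (≤-respʳ-≈ (*-comm (Λ m) (Λ n))
        (*-monoˡ-≤ (Λ-positive n) (Λ₀≤Λ m)))

    Λ≤ : ∀ x → Finite (λ n → Λ n ≤ x)
    Λ≤ x = finite (λ n → Λ n ≤? x) (upTo (proj₁ (Λ→∞ x))) (Uniqueₚ.upTo⁺ _)
      (λ Λn≤x → ∈-upTo⁺ (bound x Λn≤x))

    infix 5 _<Λ≤_
    _<Λ≤_ : ∀ x y → Finite (λ n → x < Λ n × Λ n ≤ y)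
    x <Λ≤ y = finite (λ n → x <? Λ n ×-dec Λ n ≤? y) (upTo (proj₁ (Λ→∞ y))) (Uniqueₚ.upTo⁺ _)
      (λ (_ , Λn≤y) → ∈-upTo⁺ (bound y Λn≤y))

    ΛΛ≤ : ∀ z → Finite {A = ℕ × ℕ} (λ (m , n) → Λ m * Λ n ≤ z)
    ΛΛ≤ z = finite (λ (m , n) → Λ m * Λ n ≤? z) (cartesianProduct (upTo N) (upTo N))
      (Uniqueₚ.cartesianProduct⁺ (Uniqueₚ.upTo⁺ N) (Uniqueₚ.upTo⁺ N))
      (λ {(m , n)} ΛmΛn≤z → ∈-cartesianProduct⁺
        (∈-upTo⁺ (boundˡ z n ΛmΛn≤z))
        (∈-upTo⁺ (boundˡ z m (≤-respˡ-≈ (*-comm (Λ m) (Λ n)) ΛmΛn≤z))))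
      where
      N = proj₁ (Λ→∞ (z / Λ 0))

{-# OPTIONS --safe #-}

-- Split the pairs (m , n) with λₘ λₙ ≤ x₁ x₂ into those with λₘ ≤ x₁ and
-- λₙ ≤ x₂, those with λₘ ≤ x₁ and λₙ > x₂, and those with λₘ > x₁ and λₙ ≤ x₂.
-- The fourth combination λₘ > x₁, λₙ > x₂ forces λₘ λₙ > x₁ x₂, and the first
-- one forces λₘ λₙ ≤ x₁ x₂.

module Submission where

open import Defs
open import Algebra.Bundles using (AbelianGroup; CommutativeRing)
import Algebra.Properties.AbelianGroup as AbelianGroupProperties
open import Data.List.Base using (List; []; _∷_; _++_; map; foldr; concatMap)
open import Data.List.Membership.Propositional using (_∈_; find; lose)
open import Data.List.Membership.Propositional.Properties
  using (∈-map⁺; ∈-map⁻; ∈-++⁺ˡ; ∈-++⁺ʳ; ∈-++⁻; ∈-concatMap⁺; ∈-concatMap⁻)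
open import Data.List.Membership.Propositional.Properties.WithK using (unique∧set⇒bag)
open import Data.List.Properties using (map-∘)
open import Data.List.Relation.Binary.BagAndSetEquality using (∼bag⇒↭)
open import Data.List.Relation.Binary.Permutation.Propositional using (_↭_; ↭⇒↭ₛ′)
open import Data.List.Relation.Binary.Permutation.Propositional.Properties using (map⁺)
import Data.List.Relation.Binary.Permutation.Setoid.Properties as Permutationₛₚ
import Data.List.Relation.Unary.All as All
import Data.List.Relation.Unary.All.Properties as Allₚ
import Data.List.Relation.Unary.AllPairs as AllPairs
import Data.List.Relation.Unary.AllPairs.Properties as AllPairsₚ
import Data.List.Relation.Unary.Unique.Propositional.Properties as Uniqueₚ
open import Data.Nat.Base as ℕ using (ℕ)
open import Data.Product.Base using (_×_; _,_; proj₁; proj₂; swap)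
open import Data.Product.Properties using (,-injectiveʳ)
open import Data.Sum.Base using (_⊎_; inj₁; inj₂; [_,_]′)
open import Function.Base using (_∘_)
open import Function.Bundles using (mk⇔)
open import Level using (Level)
open import Relation.Binary.Core using (_Preserves₂_⟶_⟶_)
import Relation.Binary.Properties.DecTotalOrder as DecTotalOrderProperties
open import Relation.Binary.PropositionalEquality.Core as ≡ using (_≡_; refl; cong)
import Relation.Binary.Reasoning.Setoid as SetoidReasoning
open import Relation.Nullary using (¬_; yes; no; contradiction)
open import Relation.Unary using (Pred; _∪_; _⊆_)

-- Finite sets: disjoint unions, fibred pairs, transposition.

private
  variable
    a b p q r s t : Level
    A B : Set a
    P Q : Pred A p

open Finite

disjointUnion : Finite P → Finite Q → (∀ {x} → P x → ¬ Q x) → Finite (P ∪ Q)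
disjointUnion F G P⇒¬Q = record
  { elements = elements F ++ elements G
  ; unique   = Uniqueₚ.++⁺ (unique F) (unique G)
      (λ (x∈F , x∈G) → P⇒¬Q (sound F x∈F) (sound G x∈G))
  ; sound    = λ x∈ → [ inj₁ ∘ sound F , inj₂ ∘ sound G ]′ (∈-++⁻ (elements F) x∈)
  ; complete = [ ∈-++⁺ˡ ∘ complete F , ∈-++⁺ʳ (elements F) ∘ complete G ]′
  }

module _ {P : Pred A p} {Q : A → Pred B q} (F : Finite P) (G : ∀ x → Finite (Q x)) where

  private
    fibre : A → List (A × B)
    fibre x = map (x ,_) (elements (G x))

    ∈-fibre⁻ : ∀ x {u} → u ∈ fibre x → proj₁ u ≡ x × proj₂ u ∈ elements (G x)
    ∈-fibre⁻ x u∈ with _ , y∈ , refl ← ∈-map⁻ (x ,_) u∈ = refl , y∈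

  -- Index set of an iterated sum whose inner range depends on the outer index. Listing it fibre by
  -- fibre lets the sum over pairs unfold into the iterated sum.
  dependentPairs : Finite (λ (x , y) → P x × Q x y)
  dependentPairs = record
    { elements = concatMap fibre (elements F)
    ; unique   = Uniqueₚ.concat⁺
        (Allₚ.map⁺ (All.universal (λ x → Uniqueₚ.map⁺ ,-injectiveʳ (unique (G x))) (elements F)))
        (AllPairsₚ.map⁺ (AllPairs.map fibres-disjoint (unique F)))
    ; sound    = λ u∈ → sound′ (find (∈-concatMap⁻ fibre {xs = elements F} u∈))
    ; complete = λ (Px , Qxy) → ∈-concatMap⁺ fibre
        (lose (complete F Px) (∈-map⁺ (_ ,_) (complete (G _) Qxy)))
    }
    where
    -- A common element would have both `x` and `y` as its first component.
    fibres-disjoint : ∀ {x y} → ¬ x ≡ y → ∀ {u} → ¬ (u ∈ fibre x × u ∈ fibre y)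
    fibres-disjoint {x} {y} x≢y (u∈x , u∈y)
      with refl , _ ← ∈-fibre⁻ x u∈x | refl , _ ← ∈-fibre⁻ y u∈y = x≢y refl

    sound′ : ∀ {u} → _ → P (proj₁ u) × Q (proj₁ u) (proj₂ u)
    sound′ {u} (x , x∈F , u∈) with refl , y∈ ← ∈-fibre⁻ x {u} u∈ =
      sound F x∈F , sound (G x) y∈

-- An iterated sum with outer index `n` produces pairs `(n , m)`; swapping brings them into the
-- order of the other index sets.
transpose : {P : Pred (A × B) p} → Finite P → Finite (P ∘ swap)
transpose {P = P} F = record
  { elements = map swap (elements F)
  ; unique   = Uniqueₚ.map⁺ (cong swap) (unique F)
  ; sound    = sound′
  ; complete = λ Pu → ∈-map⁺ swap (complete F Pu)
  }
  where
  sound′ : ∀ {u} → u ∈ map swap (elements F) → P (swap u)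
  sound′ u∈ with _ , v∈ , refl ← ∈-map⁻ swap u∈ = sound F v∈

-- In a list without repetitions membership has at most one proof, so having the same members
-- already makes the lists equal as bags.
elements-↭ : (F : Finite P) (G : Finite Q) → P ⊆ Q → Q ⊆ P → elements F ↭ elements G
elements-↭ F G P⊆Q Q⊆P = ∼bag⇒↭ (unique∧set⇒bag (unique F) (unique G)
  (mk⇔ (complete G ∘ P⊆Q ∘ sound F) (complete F ∘ Q⊆P ∘ sound G)))

-- Finite sums in an abelian group.

module Summation {c ℓ} (𝔾 : AbelianGroup c ℓ) where

  open AbelianGroup 𝔾 renaming (refl to ≈-refl)
  open AbelianGroupProperties 𝔾
  open SetoidReasoning setoid

  sumₗ : List A → (A → Carrier) → Carrier
  sumₗ xs f = foldr _∙_ ε (map f xs)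

  -- For the additive group of ℂ this is `sum` by definition, so results about `∑` apply to the
  -- theorem without conversion.
  ∑ : {P : Pred A p} → Finite P → (A → Carrier) → Carrier
  ∑ F = sumₗ (elements F)

  sumₗ-++ : (xs ys : List A) (f : A → Carrier) → sumₗ (xs ++ ys) f ≈ sumₗ xs f ∙ sumₗ ys f
  sumₗ-++ []       ys f = sym (identityˡ _)
  sumₗ-++ (x ∷ xs) ys f = trans (∙-congˡ (sumₗ-++ xs ys f)) (sym (assoc _ _ _))

  sumₗ-map : (g : A → B) (xs : List A) (f : B → Carrier) → sumₗ (map g xs) f ≈ sumₗ xs (f ∘ g)
  sumₗ-map g xs f = reflexive (cong (foldr _∙_ ε) (≡.sym (map-∘ xs)))

  sumₗ-concatMap : (g : A → List B) (xs : List A) (f : B → Carrier) →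
                   sumₗ (concatMap g xs) f ≈ sumₗ xs (λ x → sumₗ (g x) f)
  sumₗ-concatMap g []       f = ≈-refl
  sumₗ-concatMap g (x ∷ xs) f =
    trans (sumₗ-++ (g x) (concatMap g xs) f) (∙-congˡ (sumₗ-concatMap g xs f))

  sumₗ-cong : (xs : List A) {f g : A → Carrier} → (∀ x → f x ≈ g x) → sumₗ xs f ≈ sumₗ xs g
  sumₗ-cong []       f≈g = ≈-refl
  sumₗ-cong (x ∷ xs) f≈g = ∙-cong (f≈g x) (sumₗ-cong xs f≈g)

  -- Commutativity makes the sum invariant under permutation, so only the extent of the predicate
  -- matters, not the chosen listing.
  ∑-index : (F : Finite P) (G : Finite Q) → P ⊆ Q → Q ⊆ P → ∀ f → ∑ F f ≈ ∑ G f
  ∑-index F G P⊆Q Q⊆P f = Permutationₛₚ.foldr-commMonoid setoid isCommutativeMonoid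
    (↭⇒↭ₛ′ isEquivalence (map⁺ f (elements-↭ F G P⊆Q Q⊆P)))

  ∑-dependentPairs : {P : Pred A p} {Q : A → Pred B q}
                     (F : Finite P) (G : ∀ x → Finite (Q x)) (f : A × B → Carrier) →
                     ∑ (dependentPairs F G) f ≈ ∑ F (λ x → ∑ (G x) (λ y → f (x , y)))
  ∑-dependentPairs F G f = trans
    (sumₗ-concatMap (λ x → map (x ,_) (elements (G x))) (elements F) f)
    (sumₗ-cong (elements F) (λ x → sumₗ-map (x ,_) (elements (G x)) f))

  -- Solves a three-part decomposition of `t` for its first part: `y` and `z` are inserted with
  -- their inverses, then `y ⁻¹` is moved past `z`.
  t≈x∙y∙z⇒x≈t-y-z : ∀ {t x y z} → t ≈ (x ∙ y) ∙ z → x ≈ (t - y) - z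
  t≈x∙y∙z⇒x≈t-y-z {t} {x} {y} {z} t≈xyz = begin
    x                      ≈⟨ //-rightDividesʳ y x ⟨
    x ∙ y - y              ≈⟨ //-rightDividesʳ z _ ⟨
    (x ∙ y - y) ∙ z - z    ≈⟨ ∙-congʳ (assoc _ _ _) ⟩
    x ∙ y ∙ (y ⁻¹ ∙ z) - z ≈⟨ ∙-congʳ (∙-congˡ (comm _ _)) ⟩
    x ∙ y ∙ (z ∙ y ⁻¹) - z ≈⟨ ∙-congʳ (assoc _ _ _) ⟨
    x ∙ y ∙ z - y - z      ≈⟨ ∙-congʳ (∙-congʳ t≈xyz) ⟨
    (t - y) - z            ∎

  -- The sets P × Q, {(x , y) | P x, S x y} and {(x , y) | Q y, R y x} partition T.
  ∑-partition : {P : Pred A p} {Q : Pred B q} {S : A → Pred B s} {R : B → Pred A r}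
    {T : Pred (A × B) t}
    (F : Finite P) (G : Finite Q) (H : ∀ x → Finite (S x)) (K : ∀ y → Finite (R y))
    (L : Finite T) →
    (∀ {x y} → S x y → ¬ Q y) → (∀ {x y} → R y x → ¬ P x) →
    (∀ {x y} → T (x , y) → (P x × Q y ⊎ P x × S x y) ⊎ Q y × R y x) →
    (∀ {x y} → P x → Q y → T (x , y)) →
    (∀ {x y} → S x y → T (x , y)) →
    (∀ {x y} → R y x → T (x , y)) →
    (f : A × B → Carrier) →
    ∑ F (λ x → ∑ G (λ y → f (x , y))) ≈
      (∑ L f - ∑ F (λ x → ∑ (H x) (λ y → f (x , y)))) - ∑ G (λ y → ∑ (K y) (λ x → f (x , y)))
  ∑-partition F G H K L S⇒¬Q R⇒¬P T⊆ PQ⊆T S⊆T R⊆T f = t≈x∙y∙z⇒x≈t-y-z (begin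
    ∑ L f
      ≈⟨ ∑-index L FG∪FH∪KG T⊆ (λ
           { (inj₁ (inj₁ (Px , Qy))) → PQ⊆T Px Qy
           ; (inj₁ (inj₂ (_ , Sxy))) → S⊆T Sxy
           ; (inj₂ (_ , Ryx))        → R⊆T Ryx
           }) f ⟩
    ∑ FG∪FH∪KG f
      ≈⟨ sumₗ-++ (elements FG∪FH) (elements KG) f ⟩
    ∑ FG∪FH f ∙ ∑ KG f
      ≈⟨ ∙-cong (sumₗ-++ (elements FG) (elements FH) f) (sumₗ-map swap (elements GK) f) ⟩
    (∑ FG f ∙ ∑ FH f) ∙ ∑ GK (f ∘ swap)
      ≈⟨ ∙-cong (∙-cong (∑-dependentPairs F (λ _ → G) f) (∑-dependentPairs F H f))
                (∑-dependentPairs G K (f ∘ swap)) ⟩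
    _ ∎)
    where
    FG = dependentPairs F (λ _ → G)
    FH = dependentPairs F H
    GK = dependentPairs G K
    KG = transpose GK
    -- The second coordinate separates `FG` from `FH`; the first separates both of them from `KG`.
    FG∪FH = disjointUnion FG FH (λ (_ , Qy) (_ , Sxy) → S⇒¬Q Sxy Qy)
    FG∪FH∪KG = disjointUnion FG∪FH KG λ
      { (inj₁ (Px , _)) (_ , Ryx) → R⇒¬P Ryx Px
      ; (inj₂ (Px , _)) (_ , Ryx) → R⇒¬P Ryx Px
      }

-- Products, quotients and order in the reals.

module OrderedField {c ℓ₁ ℓ₂} (ℝ : RealNumbers c ℓ₁ ℓ₂) where

  open RealNumbers ℝ
  open CommutativeRing commutativeRing using (zeroˡ)
  open DecTotalOrderProperties decTotalOrder public using (≰⇒>; ≮⇒≥)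

  -- The factor may vanish, as `x₁` may; both products are then zero, and otherwise strict
  -- positivity gives `*-monoˡ-≤`.
  *-monoʳ-≤ : ∀ {x y z} → 0# ≤ z → x ≤ y → z * x ≤ z * y
  *-monoʳ-≤ {x} {y} {z} 0≤z x≤y with 0# ≟ z
  ... | yes 0≈z = ≤-reflexive (≈-trans (z*≈0 x) (≈-sym (z*≈0 y)))
    where
    z*≈0 : ∀ w → z * w ≈ 0#
    z*≈0 w = ≈-trans (*-congʳ (≈-sym 0≈z)) (zeroˡ w)
  ... | no  0≉z = ≤-respˡ-≈ (*-comm x z) (≤-respʳ-≈ (*-comm y z) (*-monoˡ-≤ (0≤z , 0≉z) x≤y))

  ≤/⇒*≤ : ∀ {x y z} → 0# < y → x ≤ z / y → y * x ≤ z
  ≤/⇒*≤ {x} {y} {z} 0<y x≤z/y =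
    ≤-respˡ-≈ (*-comm x y) (≤-respʳ-≈ (x/y*y≈x z 0<y) (*-monoˡ-≤ 0<y x≤z/y))

  -- By contradiction: multiplying `z / y < x` by `y` would give `z < y * x`.
  *≤⇒≤/ : ∀ {x y z} → 0# < y → y * x ≤ z → x ≤ z / y
  *≤⇒≤/ {x} {y} {z} 0<y yx≤z = ≮⇒≥ λ z/y<x → <⇒≱ (*-monoˡ-< 0<y z/y<x)
    (≤-respˡ-≈ (*-comm y x) (≤-respʳ-≈ (≈-sym (x/y*y≈x z 0<y)) yx≤z))

mainTheorem2 : ∀ {c ℓ₁ ℓ₂ : Level} (ℝ : RealNumbers c ℓ₁ ℓ₂) →
  let open RealNumbers ℝ
      open Complex ℝ
      open FiniteSum ℝ
  in
  (Λ : ℕ → Carrier)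
  (Λ-positive : ∀ n → 0# < Λ n)
  (Λ-increasing : ∀ {m n} → m ℕ.< n → Λ m < Λ n)
  (Λ→∞ : TendsToInfinity Λ)
  (φ : Carrier → Carrier → ℂ) →
  φ Preserves₂ _≈_ ⟶ _≈_ ⟶ _≈ℂ_ →
  (x₁ x₂ : Carrier) → 0# ≤ x₁ → 0# ≤ x₂ →
  let open IndexSets.Sequence ℝ Λ Λ-positive Λ-increasing Λ→∞ in
  (∑[ m ∈ Λ≤ x₁ ] ∑[ n ∈ Λ≤ x₂ ] φ (Λ m) (Λ n))
    ≈ℂ
  (((∑[ p ∈ ΛΛ≤ (x₁ * x₂) ] (let (m , n) = p in φ (Λ m) (Λ n)))
    -ℂ (∑[ m ∈ Λ≤ x₁ ] ∑[ n ∈ x₂ <Λ≤ (x₁ * x₂) / Λ m ] φ (Λ m) (Λ n)))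
    -ℂ (∑[ n ∈ Λ≤ x₂ ] ∑[ m ∈ x₁ <Λ≤ (x₁ * x₂) / Λ n ] φ (Λ m) (Λ n)))
mainTheorem2 ℝ Λ Λ-positive Λ-increasing Λ→∞ φ _ x₁ x₂ 0≤x₁ _ =
  Summation.∑-partition ℂ-+-abelianGroup
    (Λ≤ x₁) (Λ≤ x₂) (λ m → x₂ <Λ≤ (x₁ * x₂) / Λ m) (λ n → x₁ <Λ≤ (x₁ * x₂) / Λ n)
    (ΛΛ≤ (x₁ * x₂))
    (λ (x₂<Λn , _) → <⇒≱ x₂<Λn)
    (λ (x₁<Λm , _) → <⇒≱ x₁<Λm)
    (λ {m} {n} → split m n)
    -- The chain is `Λ m * Λ n ≤ x₁ * Λ n ≤ x₁ * x₂`, using `0# < Λ n` first and `0# ≤ x₁` second.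
    (λ {m} {n} Λm≤x₁ Λn≤x₂ →
      ≤-trans (*-monoˡ-≤ (Λ-positive n) Λm≤x₁) (*-monoʳ-≤ 0≤x₁ Λn≤x₂))
    (λ {m} (_ , Λn≤) → ≤/⇒*≤ (Λ-positive m) Λn≤)
    (λ {m} {n} (_ , Λm≤) → ≤-respˡ-≈ (*-comm (Λ n) (Λ m)) (≤/⇒*≤ (Λ-positive n) Λm≤))
    (λ (m , n) → φ (Λ m) (Λ n))
  where
  open RealNumbers ℝ
  open Complex ℝ
  open OrderedField ℝ
  open IndexSets.Sequence ℝ Λ Λ-positive Λ-increasing Λ→∞

  -- In the two mixed cases, dividing the bound on the product by the factor that stays within its
  -- own range gives the upper limit of the inner sum.
  split : ∀ m n → Λ m * Λ n ≤ x₁ * x₂ →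
          (Λ m ≤ x₁ × Λ n ≤ x₂ ⊎ Λ m ≤ x₁ × x₂ < Λ n × Λ n ≤ (x₁ * x₂) / Λ m)
            ⊎ Λ n ≤ x₂ × x₁ < Λ m × Λ m ≤ (x₁ * x₂) / Λ n
  split m n ΛmΛn≤ with Λ m ≤? x₁ | Λ n ≤? x₂
  ... | yes Λm≤x₁ | yes Λn≤x₂ = inj₁ (inj₁ (Λm≤x₁ , Λn≤x₂))
  ... | yes Λm≤x₁ | no  Λn≰x₂ =
    inj₁ (inj₂ (Λm≤x₁ , ≰⇒> Λn≰x₂ , *≤⇒≤/ (Λ-positive m) ΛmΛn≤))
  ... | no  Λm≰x₁ | yes Λn≤x₂ =
    inj₂ (Λn≤x₂ , ≰⇒> Λm≰x₁ , *≤⇒≤/ (Λ-positive n) (≤-respˡ-≈ (*-comm (Λ m) (Λ n)) ΛmΛn≤))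
  -- Here `Λ m * Λ n ≤ x₁ * x₂ ≤ x₁ * Λ n`, against `x₁ * Λ n < Λ m * Λ n`. Strictness has to come
  -- from `x₁ < Λ m`, since `x₁` may be zero.
  ... | no  Λm≰x₁ | no  Λn≰x₂ = contradiction
    (≤-trans ΛmΛn≤ (*-monoʳ-≤ 0≤x₁ (proj₁ (≰⇒> Λn≰x₂))))
    (<⇒≱ (*-monoˡ-< (Λ-positive n) (≰⇒> Λm≰x₁)))
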